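{- Let $C_5$ be the $3$-graph on vertex set $\{1,2,3,4,5\}$ with $3$-edges $123, 234, 345, 145, 125$. For every positive integer $n$, $$2\left\lfloor\frac n4\right\rfloor\le \mathrm{co^+ex}(n,C_5)\le \frac23 n .$$
   Context: A $3$-graph is a finite $3$-uniform hypergraph; an edge is written as the concatenation of its vertices. The minimum positive co-degree $\delta_2^+(H)$ of a non-empty $3$-graph $H$ is the maximum $k$ such that every pair of vertices contained in some edge of $H$ is contained in at least $k$ distinct edges of $H$; by convention it is $0$ if $H$ has no edges. A hypergraph is $F$-free if it has no (not necessarily induced) subhypergraph isomorphic to $F$. $\mathrm{co^+ex}(n,F)$ is the maximum of $\delta_2^+(H)$ over all $n$-vertex $F$-free $3$-graphs $H$. -}

module Defs where

open import Data.Bool using (Bool; T)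
import Data.Bool.Properties as Bool
open import Data.Fin using (Fin; #_; _≟_)
open import Data.Fin.Properties using (any?)
open import Data.Fin.Subset using (Subset; _∈_; _∪_; ⁅_⁆; ∣_∣)
open import Data.Fin.Subset.Properties using (_∈?_)
open import Data.List using (List; []; _∷_)
import Data.List.Membership.DecPropositional as DecMembership
import Data.List.Relation.Unary.All as All
open import Data.Nat using (ℕ; _≤_)
open import Data.Product using (∃; ∃-syntax; _×_)
open import Data.Sum using (_⊎_)
open import Data.Vec using (tabulate)
open import Data.Vec.Properties using (≡-dec)
open import Function.Definitions using (Injective)
open import Relation.Binary.Definitions using (DecidableEquality)
open import Relation.Binary.PropositionalEquality using (_≡_; _≢_; refl)
open import Relation.Nullary using (¬_)
open import Relation.Nullary.Decidable using (isYes; toWitness; _×-dec_)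

IsMaximum : (ℕ → Set) → ℕ → Set
IsMaximum P m = P m × (∀ k → P k → k ≤ m)

record 3-Graph (n : ℕ) : Set where
  field
    edge    : Subset n → Bool
    uniform : ∀ e → T (edge e) → ∣ e ∣ ≡ 3

  Edge : Subset n → Set
  Edge e = T (edge e)

open 3-Graph public using (Edge)

private
  variable
    m n : ℕ

NonEmpty : 3-Graph n → Set
NonEmpty H = ∃[ e ] Edge H e

EdgeThrough : 3-Graph n → Fin n → Fin n → Subset n → Set
EdgeThrough H u v e = Edge H e × u ∈ e × v ∈ e

InAtLeast : 3-Graph n → ℕ → Fin n → Fin n → Set
InAtLeast {n} H k u v =
  ∃ λ (f : Fin k → Subset n) →
    Injective _≡_ _≡_ f × (∀ i → EdgeThrough H u v (f i))

-- The graph of the function δ₂⁺: it relates H to its minimum positive co-degree.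
Isδ₂⁺ : 3-Graph n → ℕ → Set
Isδ₂⁺ {n} H d =
    (¬ NonEmpty H × d ≡ 0)
  ⊎ (NonEmpty H ×
     IsMaximum
       (λ k → ∀ (u v : Fin n) → u ≢ v →
                (∃[ e ] EdgeThrough H u v e) → InAtLeast H k u v)
       d)

image : (Fin m → Fin n) → Subset m → Subset n
image φ p = tabulate λ j → isYes (any? λ i → (i ∈? p) ×-dec (φ i ≟ j))

-- A subhypergraph of H isomorphic to F is the image of F under an injection
-- of the vertices that sends edges to edges; non-edges are unconstrained.
Contains : 3-Graph n → 3-Graph m → Set
Contains {n} {m} H F =
  ∃ λ (φ : Fin m → Fin n) →
    Injective _≡_ _≡_ φ × (∀ e → Edge F e → Edge H (image φ e))

Free : 3-Graph m → 3-Graph n → Set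
Free F H = ¬ Contains H F

-- The graph of the function co⁺ex: it relates n and F to co⁺ex(n, F).
IsCo⁺ex : ℕ → 3-Graph m → ℕ → Set
IsCo⁺ex n F =
  IsMaximum (λ k → ∃ λ (H : 3-Graph n) → Free F H × Isδ₂⁺ H k)

_≟ˢ_ : DecidableEquality (Subset n)
_≟ˢ_ = ≡-dec Bool._≟_

triple : Fin n → Fin n → Fin n → Subset n
triple i j k = ⁅ i ⁆ ∪ (⁅ j ⁆ ∪ ⁅ k ⁆)

-- Vertex i of {1,…,5} is represented by # (i - 1).
C₅-edges : List (Subset 5)
C₅-edges =
    triple (# 0) (# 1) (# 2)
  ∷ triple (# 1) (# 2) (# 3)
  ∷ triple (# 2) (# 3) (# 4)
  ∷ triple (# 0) (# 3) (# 4)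
  ∷ triple (# 0) (# 1) (# 4)
  ∷ []

C₅ : 3-Graph 5
C₅ = record
  { edge    = λ e → isYes (e ∈ˡ? C₅-edges)
  ; uniform = λ e e∈C₅ → All.lookup sizes (toWitness {a? = e ∈ˡ? C₅-edges} e∈C₅)
  }
  where
  open DecMembership (_≟ˢ_ {5}) using () renaming (_∈?_ to _∈ˡ?_)
  sizes : All.All (λ e → ∣ e ∣ ≡ 3) C₅-edges
  sizes = refl All.∷ refl All.∷ refl All.∷ refl All.∷ refl All.∷ All.[]

{-# OPTIONS --safe #-}
-- Every pair of vertices of C₅ lies in an edge, so a copy of C₅ among the rainbow
-- triples of a 4-colouring would need five colours; with colour classes of size at
-- least q every positive pair there has co-degree at least 2q.  Conversely, if all positive co-degrees are at least k and
-- 3k > 2n, then any three positive pairs have a common neighbour: an edge abc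
-- yields d completing ab, bc and ac, and then e completing cd, ad and ab, so that
-- abc, bcd, cde, ade, abe is a copy of C₅.  The maximum exists constructively
-- since 3-graphs on n vertices can be searched exhaustively up to pointwise
-- equality of their edge predicates.
module Submission where

open import Defs
open import Data.Bool using (Bool; true; false; T; T?)
open import Data.Bool.Properties using (T-≡)
import Data.Empty as Empty
open import Data.Fin using (Fin; zero; suc; #_; _≟_; toℕ; inject≤; combine; remQuot; punchIn; punchOut)
open import Data.Fin.Properties
  using (any?; all?; injective⇒≤; suc-injective; toℕ-injective; toℕ-fromℕ<; toℕ-inject≤; inject≤-injective
        ; toℕ-combine; combine-injectiveˡ; combine-remQuot; toℕ<n
        ; punchIn-injective; punchInᵢ≢i; punchIn-punchOut)
open import Data.Fin.Subset using (Subset; _∈_; _∉_; _∪_; _∩_; ⁅_⁆; ∣_∣; _⊆_; ⊥)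
open import Data.Fin.Subset.Properties
  using (_∈?_; anySubset?; Empty-unique; ∣p∣≤n; ∣⊥∣≡0; x∈⁅x⁆; x∈⁅y⁆⇒x≡y; ∣⁅x⁆∣≡1
        ; ⊆-antisym; p⊆q⇒∣p∣≤∣q∣; p⊂q⇒∣p∣<∣q∣; x∈p∩q⁻; x∈p∪q⁻; x∈p∪q⁺)
import Data.Integer as ℤ
import Data.Integer.Properties as ℤₚ
import Data.List.Membership.DecPropositional as DecMembership
import Data.List.Relation.Unary.All as All
open import Data.Nat using (ℕ; zero; suc; NonZero; _+_; _*_; _/_; _%_; _≤_; _<_; _≤?_; z≤n; s≤s)
open import Data.Nat.DivMod using (_mod_; m%n<n; m<n⇒m%n≡m; [m+kn]%n≡m%n; m/n*n≤m)
import Data.Nat.Properties as ℕ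
open import Data.Product using (Σ; ∃; ∃-syntax; _×_; _,_; proj₁; proj₂)
import Data.Rational as ℚ
import Data.Rational.Properties as ℚₚ
import Data.Rational.Unnormalised as ℚᵘ
import Data.Rational.Unnormalised.Properties as ℚᵘₚ
open import Data.Sum using (_⊎_; inj₁; inj₂; [_,_]′)
open import Data.Vec using ([]; _∷_; here; there; tabulate; lookup)
open import Data.Vec.Properties using (lookup∘tabulate; lookup⇒[]=; []=⇒lookup)
open import Function using (_∘_)
open import Function.Bundles using (module Equivalence)
open import Function.Definitions using (Injective)
open import Relation.Binary.PropositionalEquality
  using (_≡_; _≢_; _≗_; refl; sym; trans; cong; cong₂; subst; subst₂; module ≡-Reasoning)
open import Relation.Nullary using (Dec; yes; no; ¬_; contradiction)
open import Relation.Nullary.Decidable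
  using (isYes; toWitness; fromWitness; from-yes; map′; ¬?; _×-dec_; _→-dec_; _⊎-dec_; decidable-stable)
open import Relation.Unary using (Decidable)

private
  variable
    m n : ℕ

open 3-Graph using (edge; uniform)

-- Maxima of decidable bounded predicates

IsMaximum-unique : ∀ {P : ℕ → Set} {a b} → IsMaximum P a → IsMaximum P b → a ≡ b
IsMaximum-unique (Pa , a-max) (Pb , b-max) = ℕ.≤-antisym (b-max _ Pa) (a-max _ Pb)

-- The search goes down from the bound `b`: while `P b` fails the bound drops by one, and at zero
-- the given witness can only be 0.
maximum : ∀ {P : ℕ → Set} → Decidable P → ∀ b → (∀ k → P k → k ≤ b) → ∃ P → ∃ (IsMaximum P)
maximum P? b bound (k , Pk) with P? b
... | yes Pb = b , Pb , bound
maximum {P} P? zero bound (k , Pk) | no ¬P0 =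
  contradiction (subst P (ℕ.n≤0⇒n≡0 (bound k Pk)) Pk) ¬P0
maximum P? (suc b) bound (k , Pk) | no ¬Pb = maximum P? b
  (λ j Pj → ℕ.<⇒≤pred (ℕ.≤∧≢⇒< (bound j Pj) λ { refl → ¬Pb Pj })) (k , Pk)

-- Finite subsets

∈-tabulate⁺ : ∀ (f : Fin n → Bool) {x} → T (f x) → x ∈ tabulate f
∈-tabulate⁺ f {x} fx =
  lookup⇒[]= x _ (trans (lookup∘tabulate f x) (Equivalence.to T-≡ fx))

∈-tabulate⁻ : ∀ (f : Fin n → Bool) {x} → x ∈ tabulate f → T (f x)
∈-tabulate⁻ f {x} x∈ =
  Equivalence.from T-≡ (trans (sym (lookup∘tabulate f x)) ([]=⇒lookup x∈))

∣p∪q∣+∣p∩q∣≡∣p∣+∣q∣ : ∀ (p q : Subset n) → ∣ p ∪ q ∣ + ∣ p ∩ q ∣ ≡ ∣ p ∣ + ∣ q ∣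
∣p∪q∣+∣p∩q∣≡∣p∣+∣q∣ []          []          = refl
∣p∪q∣+∣p∩q∣≡∣p∣+∣q∣ (true ∷ p)  (true ∷ q)  = cong suc
  (trans (ℕ.+-suc _ _) (trans (cong suc (∣p∪q∣+∣p∩q∣≡∣p∣+∣q∣ p q)) (sym (ℕ.+-suc _ _))))
∣p∪q∣+∣p∩q∣≡∣p∣+∣q∣ (true ∷ p)  (false ∷ q) = cong suc (∣p∪q∣+∣p∩q∣≡∣p∣+∣q∣ p q)
∣p∪q∣+∣p∩q∣≡∣p∣+∣q∣ (false ∷ p) (true ∷ q)  =
  trans (cong suc (∣p∪q∣+∣p∩q∣≡∣p∣+∣q∣ p q)) (sym (ℕ.+-suc _ _))
∣p∪q∣+∣p∩q∣≡∣p∣+∣q∣ (false ∷ p) (false ∷ q) = ∣p∪q∣+∣p∩q∣≡∣p∣+∣q∣ p q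

∣p∪q∣≤∣p∣+∣q∣ : ∀ (p q : Subset n) → ∣ p ∪ q ∣ ≤ ∣ p ∣ + ∣ q ∣
∣p∪q∣≤∣p∣+∣q∣ p q = ℕ.≤-trans (ℕ.m≤m+n _ _) (ℕ.≤-reflexive (∣p∪q∣+∣p∩q∣≡∣p∣+∣q∣ p q))

∣p∣+∣q∣≤n+∣p∩q∣ : ∀ (p q : Subset n) → ∣ p ∣ + ∣ q ∣ ≤ n + ∣ p ∩ q ∣
∣p∣+∣q∣≤n+∣p∩q∣ p q = ℕ.≤-trans (ℕ.≤-reflexive (sym (∣p∪q∣+∣p∩q∣≡∣p∣+∣q∣ p q)))
  (ℕ.+-monoˡ-≤ _ (∣p∣≤n (p ∪ q)))

x∉p⇒∣⁅x⁆∪p∣≡1+∣p∣ : ∀ {x} {p : Subset n} → x ∉ p → ∣ ⁅ x ⁆ ∪ p ∣ ≡ suc ∣ p ∣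
x∉p⇒∣⁅x⁆∪p∣≡1+∣p∣ {n} {x} {p} x∉p = begin
  ∣ ⁅ x ⁆ ∪ p ∣                 ≡⟨ ℕ.+-identityʳ _ ⟨
  ∣ ⁅ x ⁆ ∪ p ∣ + 0             ≡⟨ cong (∣ ⁅ x ⁆ ∪ p ∣ +_) (trans (cong ∣_∣ disjoint) (∣⊥∣≡0 n)) ⟨
  ∣ ⁅ x ⁆ ∪ p ∣ + ∣ ⁅ x ⁆ ∩ p ∣ ≡⟨ ∣p∪q∣+∣p∩q∣≡∣p∣+∣q∣ ⁅ x ⁆ p ⟩
  ∣ ⁅ x ⁆ ∣ + ∣ p ∣             ≡⟨ cong (_+ ∣ p ∣) (∣⁅x⁆∣≡1 x) ⟩
  suc ∣ p ∣                     ∎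
  where
  open ≡-Reasoning
  disjoint : ⁅ x ⁆ ∩ p ≡ ⊥
  disjoint = Empty-unique λ (y , y∈) → let y∈⁅x⁆ , y∈p = x∈p∩q⁻ ⁅ x ⁆ p y∈ in
    x∉p (subst (_∈ p) (x∈⁅y⁆⇒x≡y x y∈⁅x⁆) y∈p)

-- Otherwise `p` would be included in `q`. Membership is decidable, so the element is found by
-- search.
∣q∣<∣p∣⇒p⊈q : ∀ {p q : Subset n} → ∣ q ∣ < ∣ p ∣ → ∃[ x ] x ∈ p × x ∉ q
∣q∣<∣p∣⇒p⊈q {p = p} {q} q<p with any? (λ x → (x ∈? p) ×-dec ¬? (x ∈? q))
... | yes found = found
... | no none   = contradiction q<p (ℕ.≤⇒≯ (p⊆q⇒∣p∣≤∣q∣ {p = p} {q} p⊆q))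
  where
  p⊆q : p ⊆ q
  p⊆q {x} x∈p = decidable-stable (x ∈? q) λ x∉q → none (x , x∈p , x∉q)

p⊆q∧∣q∣≤∣p∣⇒p≡q : ∀ {p q : Subset n} → p ⊆ q → ∣ q ∣ ≤ ∣ p ∣ → p ≡ q
p⊆q∧∣q∣≤∣p∣⇒p≡q {p = p} {q} p⊆q q≤p = ⊆-antisym p⊆q λ {x} x∈q →
  decidable-stable (x ∈? p) λ x∉p →
    ℕ.<⇒≱ (p⊂q⇒∣p∣<∣q∣ {p = p} {q} (p⊆q , x , x∈q , x∉p)) q≤p

-- Inclusion-exclusion applied twice leaves at least 3k - 2n > 0 elements in the triple
-- intersection.
triple-common : ∀ (p q r : Subset n) {k} → k ≤ ∣ p ∣ → k ≤ ∣ q ∣ → k ≤ ∣ r ∣ →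
                2 * n < 3 * k → ∃[ x ] x ∈ p × x ∈ q × x ∈ r
triple-common {n} p q r {k} k≤p k≤q k≤r 2n<3k =
  let x , x∈ , _     = ∣q∣<∣p∣⇒p⊈q {p = (p ∩ q) ∩ r} {⊥}
                         (subst (_< ∣ (p ∩ q) ∩ r ∣) (sym (∣⊥∣≡0 n)) positive)
      x∈p∩q , x∈r    = x∈p∩q⁻ (p ∩ q) r x∈
      x∈p , x∈q      = x∈p∩q⁻ p q x∈p∩q
  in x , x∈p , x∈q , x∈r
  where
  open ℕ.≤-Reasoning
  positive : 0 < ∣ (p ∩ q) ∩ r ∣
  positive = ℕ.+-cancelˡ-< (2 * n) _ _ (begin-strict
    2 * n + 0                     ≡⟨ ℕ.+-identityʳ _ ⟩
    2 * n                         <⟨ 2n<3k ⟩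
    3 * k                         ≡⟨ cong (λ j → k + (k + j)) (ℕ.+-identityʳ k) ⟩
    k + (k + k)                   ≡⟨ ℕ.+-assoc k k k ⟨
    k + k + k                     ≤⟨ ℕ.+-mono-≤ (ℕ.+-mono-≤ k≤p k≤q) k≤r ⟩
    ∣ p ∣ + ∣ q ∣ + ∣ r ∣         ≤⟨ ℕ.+-monoˡ-≤ _ (∣p∣+∣q∣≤n+∣p∩q∣ p q) ⟩
    n + ∣ p ∩ q ∣ + ∣ r ∣         ≡⟨ ℕ.+-assoc n _ _ ⟩
    n + (∣ p ∩ q ∣ + ∣ r ∣)       ≤⟨ ℕ.+-monoʳ-≤ n (∣p∣+∣q∣≤n+∣p∩q∣ (p ∩ q) r) ⟩
    n + (n + ∣ (p ∩ q) ∩ r ∣)     ≡⟨ ℕ.+-assoc n n _ ⟨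
    n + n + ∣ (p ∩ q) ∩ r ∣       ≡⟨ cong (λ j → n + j + ∣ (p ∩ q) ∩ r ∣) (ℕ.+-identityʳ n) ⟨
    2 * n + ∣ (p ∩ q) ∩ r ∣       ∎)

-- The rank of `x` in the increasing enumeration of `p`. Ranks turn injections into `p` into lower
-- bounds on its size; `member` below serves the converse.
index : ∀ {p : Subset n} {x} → x ∈ p → Fin ∣ p ∣
index here                      = zero
index (there {y = true} x∈p)  = suc (index x∈p)
index (there {y = false} x∈p) = index x∈p

index-injective : ∀ {p : Subset n} {x y} (x∈p : x ∈ p) (y∈p : y ∈ p) →
                  index x∈p ≡ index y∈p → x ≡ y
index-injective here                      here                      _  = refl
index-injective (there {y = true} x∈p)  (there {y = true} y∈p)  eq =
  cong suc (index-injective x∈p y∈p (suc-injective eq))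
index-injective (there {y = false} x∈p) (there {y = false} y∈p) eq =
  cong suc (index-injective x∈p y∈p eq)

member : ∀ (p : Subset n) → Fin ∣ p ∣ → Fin n
member (true ∷ p)  zero    = zero
member (true ∷ p)  (suc i) = suc (member p i)
member (false ∷ p) i       = suc (member p i)

member-∈ : ∀ (p : Subset n) i → member p i ∈ p
member-∈ (true ∷ p)  zero    = here
member-∈ (true ∷ p)  (suc i) = there (member-∈ p i)
member-∈ (false ∷ p) i       = there (member-∈ p i)

member-injective : ∀ (p : Subset n) → Injective _≡_ _≡_ (member p)
member-injective (true ∷ p)  {zero}  {zero}  _  = refl
member-injective (true ∷ p)  {suc i} {suc j} eq =
  cong suc (member-injective p (suc-injective eq))
member-injective (false ∷ p) eq = member-injective p (suc-injective eq)

injective⇒≤∣p∣ : ∀ {k} {p : Subset n} {f : Fin k → Fin n} →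
                 Injective _≡_ _≡_ f → (∀ i → f i ∈ p) → k ≤ ∣ p ∣
injective⇒≤∣p∣ f-inj f∈p =
  injective⇒≤ {f = index ∘ f∈p} λ {i} {j} eq → f-inj (index-injective (f∈p i) (f∈p j) eq)

-- Triples

module _ {i j k : Fin n} where

  triple-∋₁ : i ∈ triple i j k
  triple-∋₁ = x∈p∪q⁺ (inj₁ (x∈⁅x⁆ i))

  triple-∋₂ : j ∈ triple i j k
  triple-∋₂ = x∈p∪q⁺ {p = ⁅ i ⁆} (inj₂ (x∈p∪q⁺ (inj₁ (x∈⁅x⁆ j))))

  triple-∋₃ : k ∈ triple i j k
  triple-∋₃ = x∈p∪q⁺ {p = ⁅ i ⁆} (inj₂ (x∈p∪q⁺ {p = ⁅ j ⁆} (inj₂ (x∈⁅x⁆ k))))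

  ∈-triple⁻ : ∀ {x} → x ∈ triple i j k → x ≡ i ⊎ x ≡ j ⊎ x ≡ k
  ∈-triple⁻ x∈ with x∈p∪q⁻ ⁅ i ⁆ _ x∈
  ... | inj₁ x∈i = inj₁ (x∈⁅y⁆⇒x≡y i x∈i)
  ... | inj₂ x∈jk with x∈p∪q⁻ ⁅ j ⁆ ⁅ k ⁆ x∈jk
  ...   | inj₁ x∈j = inj₂ (inj₁ (x∈⁅y⁆⇒x≡y j x∈j))
  ...   | inj₂ x∈k = inj₂ (inj₂ (x∈⁅y⁆⇒x≡y k x∈k))

  triple-⊆ : ∀ {p} → i ∈ p → j ∈ p → k ∈ p → triple i j k ⊆ p
  triple-⊆ i∈p j∈p k∈p x∈ with ∈-triple⁻ x∈
  ... | inj₁ refl        = i∈p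
  ... | inj₂ (inj₁ refl) = j∈p
  ... | inj₂ (inj₂ refl) = k∈p

  ∣triple∣≡3 : i ≢ j → i ≢ k → j ≢ k → ∣ triple i j k ∣ ≡ 3
  ∣triple∣≡3 i≢j i≢k j≢k =
    trans (x∉p⇒∣⁅x⁆∪p∣≡1+∣p∣ i∉) (cong suc
      (trans (x∉p⇒∣⁅x⁆∪p∣≡1+∣p∣ (j≢k ∘ x∈⁅y⁆⇒x≡y k)) (cong suc (∣⁅x⁆∣≡1 k))))
    where
    i∉ : i ∉ ⁅ j ⁆ ∪ ⁅ k ⁆
    i∉ i∈ = [ i≢j ∘ x∈⁅y⁆⇒x≡y j , i≢k ∘ x∈⁅y⁆⇒x≡y k ]′ (x∈p∪q⁻ ⁅ j ⁆ ⁅ k ⁆ i∈)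

∣pair∣≤2 : ∀ (x y : Fin n) → ∣ ⁅ x ⁆ ∪ ⁅ y ⁆ ∣ ≤ 2
∣pair∣≤2 x y = ℕ.≤-trans (∣p∪q∣≤∣p∣+∣q∣ ⁅ x ⁆ ⁅ y ⁆)
  (ℕ.≤-reflexive (cong₂ _+_ (∣⁅x⁆∣≡1 x) (∣⁅x⁆∣≡1 y)))

-- If two entries coincide, the triple is included in a pair and has at most two elements.
∣triple∣≡3⇒distinct : ∀ {i j k : Fin n} → ∣ triple i j k ∣ ≡ 3 → i ≢ j × i ≢ k × j ≢ k
∣triple∣≡3⇒distinct {n} {i} {j} {k} size =
    (λ { refl → small j k left left right })
  , (λ { refl → small i j left right left })
  , (λ { refl → small i j left right right })
  where
  left : ∀ {x y : Fin n} → x ∈ ⁅ x ⁆ ∪ ⁅ y ⁆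
  left = x∈p∪q⁺ (inj₁ (x∈⁅x⁆ _))
  right : ∀ {x y : Fin n} → y ∈ ⁅ x ⁆ ∪ ⁅ y ⁆
  right {x} = x∈p∪q⁺ {p = ⁅ x ⁆} (inj₂ (x∈⁅x⁆ _))
  small : ∀ x y → let p = ⁅ x ⁆ ∪ ⁅ y ⁆ in i ∈ p → j ∈ p → k ∈ p → Empty.⊥
  small x y i∈p j∈p k∈p = ℕ.≤⇒≯ (∣pair∣≤2 x y)
    (ℕ.≤-trans (ℕ.≤-reflexive (sym size))
      (p⊆q⇒∣p∣≤∣q∣ {p = triple i j k} {⁅ x ⁆ ∪ ⁅ y ⁆} (triple-⊆ i∈p j∈p k∈p)))

-- A pair has at most two elements, so `e` contains some `w` outside it; then `triple u v w` is a
-- subset of `e` of the same size.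
third-vertex : ∀ {e : Subset n} {u v} → ∣ e ∣ ≡ 3 → u ∈ e → v ∈ e → u ≢ v →
               ∃[ w ] e ≡ triple u v w
third-vertex {e = e} {u} {v} size u∈e v∈e u≢v =
  let w , w∈e , w∉uv = ∣q∣<∣p∣⇒p⊈q {p = e} {⁅ u ⁆ ∪ ⁅ v ⁆}
                         (ℕ.≤-trans (s≤s (∣pair∣≤2 u v)) (ℕ.≤-reflexive (sym size)))
      u≢w = λ u≡w → w∉uv (x∈p∪q⁺ (inj₁ (subst (_∈ ⁅ u ⁆) u≡w (x∈⁅x⁆ u))))
      v≢w = λ v≡w → w∉uv (x∈p∪q⁺ {p = ⁅ u ⁆} (inj₂ (subst (_∈ ⁅ v ⁆) v≡w (x∈⁅x⁆ v))))
  in w , sym (p⊆q∧∣q∣≤∣p∣⇒p≡q (triple-⊆ u∈e v∈e w∈e)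
           (ℕ.≤-reflexive (trans size (sym (∣triple∣≡3 u≢v u≢w v≢w)))))

∣e∣≡3⇒triple : ∀ {e : Subset n} → ∣ e ∣ ≡ 3 → ∃[ i ] ∃[ j ] ∃[ k ] e ≡ triple i j k
∣e∣≡3⇒triple {n} {e} size =
  let i , i∈e , _    = ∣q∣<∣p∣⇒p⊈q {p = e} {⊥} (subst₂ _<_ (sym (∣⊥∣≡0 n)) (sym size) (s≤s z≤n))
      j , j∈e , j∉i  = ∣q∣<∣p∣⇒p⊈q {p = e} {⁅ i ⁆}
                         (subst₂ _<_ (sym (∣⁅x⁆∣≡1 i)) (sym size) (s≤s (s≤s z≤n)))
      k , e≡ijk      = third-vertex size i∈e j∈e λ i≡j → j∉i (subst (_∈ ⁅ i ⁆) i≡j (x∈⁅x⁆ i))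
  in i , j , k , e≡ijk

-- Positive co-degrees

-- The predicate whose maximum defines `Isδ₂⁺` on non-empty 3-graphs.
CodegreesAtLeast : 3-Graph n → ℕ → Set
CodegreesAtLeast {n} H k =
  ∀ (u v : Fin n) → u ≢ v → (∃[ e ] EdgeThrough H u v e) → InAtLeast H k u v

-- No clause excludes `u` and `v` themselves: a triple with a repeated vertex has fewer than three
-- elements and is not an edge.
neighbours : 3-Graph n → Fin n → Fin n → Subset n
neighbours H u v = tabulate λ w → edge H (triple u v w)

module _ (H : 3-Graph n) where

  Edge-distinct : ∀ {i j k} → Edge H (triple i j k) → i ≢ j × i ≢ k × j ≢ k
  Edge-distinct e = ∣triple∣≡3⇒distinct (uniform H _ e)

  ∈-neighbours⁺ : ∀ {u v w} → Edge H (triple u v w) → w ∈ neighbours H u v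
  ∈-neighbours⁺ {u} {v} = ∈-tabulate⁺ (λ w → edge H (triple u v w))

  ∈-neighbours⁻ : ∀ {u v w} → w ∈ neighbours H u v → Edge H (triple u v w)
  ∈-neighbours⁻ {u} {v} = ∈-tabulate⁻ (λ w → edge H (triple u v w))

  -- An edge through `u` and `v` is determined by its third vertex, so distinct edges have distinct
  -- third vertices.
  InAtLeast⇒≤∣neighbours∣ : ∀ {k u v} → u ≢ v → InAtLeast H k u v → k ≤ ∣ neighbours H u v ∣
  InAtLeast⇒≤∣neighbours∣ {k} {u} {v} u≢v (f , f-inj , f-edge) = injective⇒≤∣p∣ {f = g}
    (λ {i} {j} gi≡gj → f-inj (trans (f≡ i) (trans (cong (triple u v) gi≡gj) (sym (f≡ j)))))
    (λ i → ∈-neighbours⁺ (subst (Edge H) (f≡ i) (proj₁ (f-edge i))))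
    where
    third : ∀ i → ∃[ w ] f i ≡ triple u v w
    third i = let e , u∈ , v∈ = f-edge i in third-vertex (uniform H _ e) u∈ v∈ u≢v
    g : Fin k → Fin n
    g i = proj₁ (third i)
    f≡ : ∀ i → f i ≡ triple u v (g i)
    f≡ i = proj₂ (third i)

  ≤∣neighbours∣⇒InAtLeast : ∀ {k u v} → k ≤ ∣ neighbours H u v ∣ → InAtLeast H k u v
  ≤∣neighbours∣⇒InAtLeast {k} {u} {v} k≤ =
      (λ i → triple u v (w i)) , inj , λ i → e i , triple-∋₁ , triple-∋₂ {i = u}
    where
    p = neighbours H u v
    w : Fin k → Fin n
    w i = member p (inject≤ i k≤)
    e : ∀ i → Edge H (triple u v (w i))
    e i = ∈-neighbours⁻ (member-∈ p (inject≤ i k≤))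
    inj : Injective _≡_ _≡_ (λ i → triple u v (w i))
    -- The vertex `w i` lies in the triple of `j` and differs from `u` and `v`, so it must be `w j`.
    inj {i} {j} eq with ∈-triple⁻ {i = u} {v} (subst (w i ∈_) eq (triple-∋₃ {i = u} {v}))
    ... | inj₁ wi≡u        = contradiction (sym wi≡u) (proj₁ (proj₂ (Edge-distinct (e i))))
    ... | inj₂ (inj₁ wi≡v) = contradiction (sym wi≡v) (proj₂ (proj₂ (Edge-distinct (e i))))
    ... | inj₂ (inj₂ wi≡wj) = inject≤-injective k≤ k≤ i j (member-injective p wi≡wj)

  NonEmpty? : Dec (NonEmpty H)
  NonEmpty? = anySubset? λ e → T? (edge H e)

  -- For a pair of distinct vertices, `InAtLeast` is equivalent to a comparison with the size of the
  -- neighbourhood, which avoids a search over families of edges.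
  CodegreesAtLeast? : Decidable (CodegreesAtLeast H)
  CodegreesAtLeast? k = all? λ u → all? λ v → pair? u v
    where
    pair? : ∀ u v → Dec (u ≢ v → (∃[ e ] EdgeThrough H u v e) → InAtLeast H k u v)
    pair? u v with u ≟ v
    ... | yes u≡v = yes λ u≢v → contradiction u≡v u≢v
    ... | no u≢v  = map′ (λ f _ → f) (λ f → f u≢v)
      (anySubset? (λ e → T? (edge H e) ×-dec ((u ∈? e) ×-dec (v ∈? e)))
       →-dec map′ ≤∣neighbours∣⇒InAtLeast (InAtLeast⇒≤∣neighbours∣ u≢v)
               (k ≤? ∣ neighbours H u v ∣))

  module _ {k} (codeg : CodegreesAtLeast H k) where

    codegree : ∀ {u v e} → u ≢ v → Edge H e → u ∈ e → v ∈ e → k ≤ ∣ neighbours H u v ∣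
    codegree u≢v e u∈ v∈ = InAtLeast⇒≤∣neighbours∣ u≢v (codeg _ _ u≢v (_ , e , u∈ , v∈))

    codegree-≤ : NonEmpty H → k ≤ n
    codegree-≤ (e , He) =
      let i , j , l , e≡ijl = ∣e∣≡3⇒triple (uniform H e He)
          ijl = subst (Edge H) e≡ijl He
      in ℕ.≤-trans (codegree (proj₁ (Edge-distinct ijl)) ijl triple-∋₁ (triple-∋₂ {i = i}))
                   (∣p∣≤n (neighbours H i j))

  δ₂⁺-nonEmpty : NonEmpty H → ∃ (IsMaximum (CodegreesAtLeast H))
  δ₂⁺-nonEmpty ne = maximum CodegreesAtLeast? n (λ k codeg → codegree-≤ codeg ne)
    -- Every pair lies in at least zero edges, by the empty family.
    (0 , λ u v _ _ → (λ ()) , (λ { {()} }) , λ ())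

  Isδ₂⁺-exists : ∃ (Isδ₂⁺ H)
  Isδ₂⁺-exists with NonEmpty?
  ... | yes ne = let d , max = δ₂⁺-nonEmpty ne in d , inj₂ (ne , max)
  ... | no ¬ne = 0 , inj₁ (¬ne , refl)

  Isδ₂⁺-unique : ∀ {a b} → Isδ₂⁺ H a → Isδ₂⁺ H b → a ≡ b
  Isδ₂⁺-unique (inj₁ (_ , refl))  (inj₁ (_ , refl))  = refl
  Isδ₂⁺-unique (inj₁ (¬ne , _))   (inj₂ (ne , _))    = contradiction ne ¬ne
  Isδ₂⁺-unique (inj₂ (ne , _))    (inj₁ (¬ne , _))   = contradiction ne ¬ne
  Isδ₂⁺-unique (inj₂ (_ , a-max)) (inj₂ (_ , b-max)) = IsMaximum-unique a-max b-max

  -- The value exists and is unique, so it suffices to compare `d` with it.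
  Isδ₂⁺? : Decidable (Isδ₂⁺ H)
  Isδ₂⁺? d = let d′ , isδ = Isδ₂⁺-exists in
    map′ (λ { refl → isδ }) (λ isδ′ → Isδ₂⁺-unique isδ isδ′) (d′ ℕ.≟ d)

-- Copies of C₅

image-⊆ : ∀ (φ : Fin m → Fin n) {p q} → (∀ {i} → i ∈ p → φ i ∈ q) → image φ p ⊆ q
image-⊆ φ {q = q} hyp x∈ =
  let i , i∈p , φi≡x = toWitness (∈-tabulate⁻ _ x∈) in subst (_∈ q) φi≡x (hyp i∈p)

∈-image : ∀ (φ : Fin m → Fin n) {p i} → i ∈ p → φ i ∈ image φ p
∈-image φ {i = i} i∈p = ∈-tabulate⁺ _ (fromWitness (i , i∈p , refl))

image-triple : ∀ (φ : Fin m → Fin n) i j k →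
               image φ (triple i j k) ≡ triple (φ i) (φ j) (φ k)
image-triple φ i j k = ⊆-antisym (image-⊆ φ sub)
  (triple-⊆ {i = φ i} (∈-image φ triple-∋₁) (∈-image φ (triple-∋₂ {i = i}))
            (∈-image φ (triple-∋₃ {i = i} {j})))
  where
  sub : ∀ {l} → l ∈ triple i j k → φ l ∈ triple (φ i) (φ j) (φ k)
  sub l∈ with ∈-triple⁻ {i = i} l∈
  ... | inj₁ refl        = triple-∋₁
  ... | inj₂ (inj₁ refl) = triple-∋₂ {i = φ i}
  ... | inj₂ (inj₂ refl) = triple-∋₃ {i = φ i} {φ j}

-- abstract keeps the decision procedure from being unfolded by later conversion checks.
abstract
  C₅-covers-pairs : ∀ i j → i ≢ j → ∃[ k ] Edge C₅ (triple i j k)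
  C₅-covers-pairs = from-yes
    (all? λ i → all? λ j → ¬? (i ≟ j) →-dec any? λ k → T? (edge C₅ (triple i j k)))

-- Distinctness of the five vertices is not demanded; it follows from the edges.
PentagonAt : 3-Graph n → (a b c d e : Fin n) → Set
PentagonAt H a b c d e =
  Edge H (triple a b c) × Edge H (triple b c d) × Edge H (triple c d e) ×
  Edge H (triple a d e) × Edge H (triple a b e)

Pentagon : 3-Graph n → Set
Pentagon H = ∃[ a ] ∃[ b ] ∃[ c ] ∃[ d ] ∃[ e ] PentagonAt H a b c d e

module _ (H : 3-Graph n) where

  -- Any two vertices of `C₅` share an edge, whose image is an edge of `H` and hence has distinct
  -- entries. This makes `φ` injective.
  Pentagon⇒Contains : Pentagon H → Contains H C₅
  Pentagon⇒Contains (a , b , c , d , e , abc , bcd , cde , ade , abe) =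
    φ , φ-injective , λ p p∈C₅ → All.lookup edges (toWitness {a? = p ∈ˡ? C₅-edges} p∈C₅)
    where
    open DecMembership (_≟ˢ_ {5}) using () renaming (_∈?_ to _∈ˡ?_)
    φ : Fin 5 → Fin n
    φ = lookup (a ∷ b ∷ c ∷ d ∷ e ∷ [])
    at : ∀ i j k → Edge H (triple (φ i) (φ j) (φ k)) → Edge H (image φ (triple i j k))
    at i j k = subst (Edge H) (sym (image-triple φ i j k))
    edges : All.All (λ p → Edge H (image φ p)) C₅-edges
    edges = at (# 0) (# 1) (# 2) abc All.∷ at (# 1) (# 2) (# 3) bcd All.∷
            at (# 2) (# 3) (# 4) cde All.∷ at (# 0) (# 3) (# 4) ade All.∷
            at (# 0) (# 1) (# 4) abe All.∷ All.[]
    φ-injective : Injective _≡_ _≡_ φ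
    φ-injective {i} {j} φi≡φj = decidable-stable (i ≟ j) λ i≢j →
      let k , ijk = C₅-covers-pairs i j i≢j in
      proj₁ (Edge-distinct H (subst (Edge H) (image-triple φ i j k)
        (All.lookup edges (toWitness {a? = triple i j k ∈ˡ? C₅-edges} ijk)))) φi≡φj

  Contains⇒Pentagon : Contains H C₅ → Pentagon H
  Contains⇒Pentagon (φ , _ , φ-edge) =
    φ (# 0) , φ (# 1) , φ (# 2) , φ (# 3) , φ (# 4) ,
    -- Membership of each concrete triple in `C₅` evaluates to true, so each `_` is filled by the
    -- unit element.
    at (# 0) (# 1) (# 2) _ , at (# 1) (# 2) (# 3) _ , at (# 2) (# 3) (# 4) _ ,
    at (# 0) (# 3) (# 4) _ , at (# 0) (# 1) (# 4) _
    where
    at : ∀ i j k → Edge C₅ (triple i j k) → Edge H (triple (φ i) (φ j) (φ k))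
    at i j k ijk = subst (Edge H) (image-triple φ i j k) (φ-edge _ ijk)

  -- A search over five vertices replaces the search over injections.
  Contains-C₅? : Dec (Contains H C₅)
  Contains-C₅? = map′ Pentagon⇒Contains Contains⇒Pentagon
    (any? λ a → any? λ b → any? λ c → any? λ d → any? λ e →
      T? (edge H (triple a b c)) ×-dec (T? (edge H (triple b c d)) ×-dec
      (T? (edge H (triple c d e)) ×-dec (T? (edge H (triple a d e)) ×-dec
      T? (edge H (triple a b e))))))

  -- The upper bound by common neighbours

  module _ {k} (codeg : CodegreesAtLeast H k) (2n<3k : 2 * n < 3 * k) where

    common-neighbour : ∀ {u v u′ v′ u″ v″} → let N = neighbours H in
      k ≤ ∣ N u v ∣ → k ≤ ∣ N u′ v′ ∣ → k ≤ ∣ N u″ v″ ∣ →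
      ∃[ x ] Edge H (triple u v x) × Edge H (triple u′ v′ x) × Edge H (triple u″ v″ x)
    common-neighbour p q r =
      let x , x∈p , x∈q , x∈r = triple-common _ _ _ p q r 2n<3k
      in x , ∈-neighbours⁻ H x∈p , ∈-neighbours⁻ H x∈q , ∈-neighbours⁻ H x∈r

    module _ {a b c} (abc : Edge H (triple a b c)) where

      codegree₁₂ : k ≤ ∣ neighbours H a b ∣
      codegree₁₂ = codegree H codeg (proj₁ (Edge-distinct H abc)) abc
                     triple-∋₁ (triple-∋₂ {i = a})

      codegree₁₃ : k ≤ ∣ neighbours H a c ∣
      codegree₁₃ = codegree H codeg (proj₁ (proj₂ (Edge-distinct H abc))) abc
                     triple-∋₁ (triple-∋₃ {i = a} {b})

      codegree₂₃ : k ≤ ∣ neighbours H b c ∣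
      codegree₂₃ = codegree H codeg (proj₂ (proj₂ (Edge-distinct H abc))) abc
                     (triple-∋₂ {i = a}) (triple-∋₃ {i = a} {b})

    Edge⇒Pentagon : ∀ a b c → Edge H (triple a b c) → Pentagon H
    Edge⇒Pentagon a b c abc =
      let d , abd , bcd , acd = common-neighbour (codegree₁₂ abc) (codegree₂₃ abc) (codegree₁₃ abc)
          -- The three pairs are positive because they lie in edges already found: cd in bcd, ad in
          -- abd, ab in abc.
          e , cde , ade , abe = common-neighbour (codegree₂₃ bcd) (codegree₁₃ abd) (codegree₁₂ abc)
      in a , b , c , d , e , abc , bcd , cde , ade , abe

    codegrees⇒Pentagon : NonEmpty H → Pentagon H
    codegrees⇒Pentagon (p , Hp) =
      let a , b , c , p≡abc = ∣e∣≡3⇒triple (uniform H p Hp)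
      in Edge⇒Pentagon a b c (subst (Edge H) p≡abc Hp)

  δ₂⁺-upper-bound : ∀ {k} → Free C₅ H → Isδ₂⁺ H k → 3 * k ≤ 2 * n
  δ₂⁺-upper-bound free (inj₁ (_ , refl)) = z≤n
  δ₂⁺-upper-bound free (inj₂ (ne , codeg , _)) =
    ℕ.≮⇒≥ λ 2n<3k → free (Pentagon⇒Contains (codegrees⇒Pentagon codeg 2n<3k ne))

-- Exhaustive search over 3-graphs

-- Induction on `n`: a predicate on subsets of `suc n` points splits into two predicates on subsets
-- of `n` points, according to the first bit. Regluing the halves recovers the predicate only
-- pointwise, hence the assumption that `P` respects `≗`.
anySubsetPredicate? : ∀ {P : (Subset n → Bool) → Set} → (∀ {f g} → f ≗ g → P f → P g) →
                      (∀ f → Dec (P f)) → Dec (∃ P)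
anySubsetPredicate? {zero} {P} resp P? =
  map′ [ (λ p → _ , p) , (λ p → _ , p) ]′ from (P? (λ _ → true) ⊎-dec P? (λ _ → false))
  where
  from : ∃ P → P (λ _ → true) ⊎ P (λ _ → false)
  from (f , Pf) with f [] in eq
  ... | true  = inj₁ (resp (λ { [] → eq }) Pf)
  ... | false = inj₂ (resp (λ { [] → eq }) Pf)
anySubsetPredicate? {suc n} {P} resp P? =
  map′ (λ (f , g , Pfg) → glue f g , Pfg)
       (λ (h , Ph) → (h ∘ (true ∷_)) , (h ∘ (false ∷_)) ,
                     resp (λ { (true ∷ p) → refl ; (false ∷ p) → refl }) Ph)
       (anySubsetPredicate?
         (λ f≗f′ (g , Pfg) → g , resp (glue-cong f≗f′ (λ _ → refl)) Pfg)
         (λ f → anySubsetPredicate? (λ g≗g′ → resp (glue-cong {f} (λ _ → refl) g≗g′))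
                                    (λ g → P? (glue f g))))
  where
  glue : (f g : Subset n → Bool) → Subset (suc n) → Bool
  glue f g (true ∷ p)  = f p
  glue f g (false ∷ p) = g p
  glue-cong : ∀ {f f′ g g′} → f ≗ f′ → g ≗ g′ → glue f g ≗ glue f′ g′
  glue-cong f≗f′ g≗g′ (true ∷ p)  = f≗f′ p
  glue-cong f≗f′ g≗g′ (false ∷ p) = g≗g′ p

module _ {H H′ : 3-Graph n} where

  NonEmpty-mono : (∀ {e} → Edge H e → Edge H′ e) → NonEmpty H → NonEmpty H′
  NonEmpty-mono H⊆H′ (e , He) = e , H⊆H′ He

  Contains-mono : (∀ {e} → Edge H e → Edge H′ e) → {F : 3-Graph m} → Contains H F → Contains H′ F
  Contains-mono H⊆H′ (φ , φ-inj , φ-edge) = φ , φ-inj , λ e Fe → H⊆H′ (φ-edge e Fe)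

  -- One inclusion transports the positivity of a pair back to `H`, the other carries the edges
  -- through it over to `H′`.
  CodegreesAtLeast-resp : (∀ {e} → Edge H e → Edge H′ e) → (∀ {e} → Edge H′ e → Edge H e) →
                          ∀ {k} → CodegreesAtLeast H k → CodegreesAtLeast H′ k
  CodegreesAtLeast-resp H⊆H′ H′⊆H codeg u v u≢v (e , H′e , uv∈e) =
    let f , f-inj , f-edge = codeg u v u≢v (e , H′⊆H H′e , uv∈e)
    in f , f-inj , λ i → H⊆H′ (proj₁ (f-edge i)) , proj₂ (f-edge i)

Isδ₂⁺-resp : ∀ {H H′ : 3-Graph n} → (∀ {e} → Edge H e → Edge H′ e) →
             (∀ {e} → Edge H′ e → Edge H e) → ∀ {d} → Isδ₂⁺ H d → Isδ₂⁺ H′ d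
Isδ₂⁺-resp {H = H} {H′} H⊆H′ H′⊆H (inj₁ (¬ne , d≡0)) =
  inj₁ (¬ne ∘ NonEmpty-mono {H = H′} {H} H′⊆H , d≡0)
Isδ₂⁺-resp {H = H} {H′} H⊆H′ H′⊆H (inj₂ (ne , codeg , max)) =
  inj₂ (NonEmpty-mono {H = H} {H′} H⊆H′ ne , CodegreesAtLeast-resp {H = H} {H′} H⊆H′ H′⊆H codeg ,
        λ k codeg′ → max k (CodegreesAtLeast-resp {H = H′} {H} H′⊆H H⊆H′ codeg′))

Attained : ℕ → ℕ → Set
Attained n k = ∃ λ (H : 3-Graph n) → Free C₅ H × Isδ₂⁺ H k

Attained? : ∀ n → Decidable (Attained n)
Attained? n k = map′ (λ (f , u , good) → record { edge = f ; uniform = u } , good)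
                     (λ (H , good) → edge H , uniform H , good)
                     (anySubsetPredicate? resp P?)
  where
  Uniform : (Subset n → Bool) → Set
  Uniform f = ∀ e → T (f e) → ∣ e ∣ ≡ 3
  P : (Subset n → Bool) → Set
  -- Uniformity becomes part of the predicate, so that the search ranges over bare Boolean
  -- functions.
  P f = Σ (Uniform f) λ u → let H = record { edge = f ; uniform = u } in Free C₅ H × Isδ₂⁺ H k
  resp : ∀ {f g} → f ≗ g → P f → P g
  resp {f} {g} f≗g (u , free , isδ) =
      (λ e ge → u e (g⇒f ge))
    , (λ c → free (Contains-mono {H = G} {F} g⇒f {C₅} c))
    , Isδ₂⁺-resp {H = F} {G} f⇒g g⇒f isδ
    where
    f⇒g : ∀ {e} → T (f e) → T (g e)
    f⇒g {e} = subst T (f≗g e)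
    g⇒f : ∀ {e} → T (g e) → T (f e)
    g⇒f {e} = subst T (sym (f≗g e))
    F G : 3-Graph n
    F = record { edge = f ; uniform = u }
    G = record { edge = g ; uniform = λ e ge → u e (g⇒f ge) }
  Uniform? : ∀ f → Dec (Uniform f)
  Uniform? f with anySubset? (λ e → T? (f e) ×-dec ¬? (∣ e ∣ ℕ.≟ 3))
  ... | yes (e , fe , e≢3) = no λ u → e≢3 (u e fe)
  ... | no none = yes λ e fe → decidable-stable (∣ e ∣ ℕ.≟ 3) λ e≢3 → none (e , fe , e≢3)
  P? : ∀ f → Dec (P f)
  P? f with Uniform? f
  ... | no ¬u = no (¬u ∘ proj₁)
  ... | yes u = let H = record { edge = f ; uniform = u } in
    -- Freeness and co-degree mention only the edge predicate, so any uniformity proof may be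
    -- exchanged for `u`.
    map′ (u ,_) proj₂ (¬? (Contains-C₅? H) ×-dec Isδ₂⁺? H k)

Attained⇒≤ : ∀ {k} → Attained n k → 3 * k ≤ 2 * n
Attained⇒≤ (H , free , isδ) = δ₂⁺-upper-bound H free isδ

co⁺ex-exists : ∀ n → ∃ (IsCo⁺ex n C₅)
co⁺ex-exists n = maximum (Attained? n) (2 * n)
  -- A crude search bound: k ≤ 3k ≤ 2n.
  (λ k att → ℕ.≤-trans (ℕ.m≤m+n k (2 * k)) (Attained⇒≤ att)) empty-attained
  where
  ∅ : 3-Graph n
  ∅ = record { edge = λ _ → false ; uniform = λ _ () }
  empty-attained : ∃ (Attained n)
  empty-attained = 0 , ∅ , (λ (_ , _ , φ-edge) → φ-edge (triple (# 0) (# 1) (# 2)) _) , inj₁ (proj₂ , refl)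

-- Rainbow triples of a 4-colouring

module Rainbow (col : Fin n → Fin 4) where

  IsRainbow : Subset n → Set
  IsRainbow e = ∣ e ∣ ≡ 3 × (∀ i j → i ∈ e → j ∈ e → col i ≡ col j → i ≡ j)

  IsRainbow? : Decidable IsRainbow
  IsRainbow? e = (∣ e ∣ ℕ.≟ 3) ×-dec
    all? λ i → all? λ j → (i ∈? e) →-dec ((j ∈? e) →-dec ((col i ≟ col j) →-dec (i ≟ j)))

  rainbow : 3-Graph n
  rainbow = record
    { edge    = λ e → isYes (IsRainbow? e)
    ; uniform = λ e e∈ → proj₁ (toWitness {a? = IsRainbow? e} e∈)
    }

  Edge⇒distinct-colours : ∀ {e i j} → Edge rainbow e → i ∈ e → j ∈ e → i ≢ j → col i ≢ col j
  Edge⇒distinct-colours {e} {i} {j} He i∈e j∈e i≢j ci≡cj =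
    i≢j (proj₂ (toWitness {a? = IsRainbow? e} He) i j i∈e j∈e ci≡cj)

  distinct-colours⇒Edge : ∀ {i j k} → col i ≢ col j → col i ≢ col k → col j ≢ col k →
                          Edge rainbow (triple i j k)
  distinct-colours⇒Edge {i} {j} {k} ci≢cj ci≢ck cj≢ck = fromWitness {a? = IsRainbow? (triple i j k)}
    (∣triple∣≡3 (ci≢cj ∘ cong col) (ci≢ck ∘ cong col) (cj≢ck ∘ cong col) , inj)
    where
    inj : ∀ x y → x ∈ triple i j k → y ∈ triple i j k → col x ≡ col y → x ≡ y
    inj x y x∈ y∈ cx≡cy with ∈-triple⁻ {i = i} x∈ | ∈-triple⁻ {i = i} y∈
    ... | inj₁ refl        | inj₁ refl        = refl
    ... | inj₁ refl        | inj₂ (inj₁ refl) = contradiction cx≡cy ci≢cj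
    ... | inj₁ refl        | inj₂ (inj₂ refl) = contradiction cx≡cy ci≢ck
    ... | inj₂ (inj₁ refl) | inj₁ refl        = contradiction (sym cx≡cy) ci≢cj
    ... | inj₂ (inj₁ refl) | inj₂ (inj₁ refl) = refl
    ... | inj₂ (inj₁ refl) | inj₂ (inj₂ refl) = contradiction cx≡cy cj≢ck
    ... | inj₂ (inj₂ refl) | inj₁ refl        = contradiction (sym cx≡cy) ci≢ck
    ... | inj₂ (inj₂ refl) | inj₂ (inj₁ refl) = contradiction (sym cx≡cy) cj≢ck
    ... | inj₂ (inj₂ refl) | inj₂ (inj₂ refl) = refl

  rainbow-Free : Free C₅ rainbow
  -- An injection from `Fin 5` to `Fin 4` would give 5 ≤ 4.
  rainbow-Free (φ , φ-inj , φ-edge) = ℕ.1+n≰n (injective⇒≤ colφ-injective)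
    where
    colφ-injective : Injective _≡_ _≡_ (col ∘ φ)
    colφ-injective {i} {j} eq = decidable-stable (i ≟ j) λ i≢j →
      let k , ijk = C₅-covers-pairs i j i≢j in
      Edge⇒distinct-colours {image φ (triple i j k)} {φ i} {φ j}
        (φ-edge _ ijk) (∈-image φ triple-∋₁) (∈-image φ (triple-∋₂ {i = i}))
        (i≢j ∘ φ-inj) eq

  module _ {q} (pick : Fin 4 → Fin q → Fin n) (col-pick : ∀ c i → col (pick c i) ≡ c)
           (pick-injective : ∀ c → Injective _≡_ _≡_ (pick c)) where

    -- A positive pair uses two different colours. Each of the two remaining colours supplies `q`
    -- vertices through `pick`, and every one of them completes the pair to a rainbow triple.
    rainbow-codegrees : CodegreesAtLeast rainbow (2 * q)
    rainbow-codegrees u v u≢v (e , He , u∈e , v∈e) =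
      ≤∣neighbours∣⇒InAtLeast rainbow (injective⇒≤∣p∣ {f = w} w-injective λ x →
        ∈-neighbours⁺ rainbow (distinct-colours⇒Edge cu≢cv
          (λ eq → punchInᵢ≢i (col u) _ (sym (trans eq (col-pick _ _))))
          (λ eq → cv-avoided (proj₁ (remQuot {2} q x)) (trans eq (col-pick _ _)))))
      where
      cu≢cv : col u ≢ col v
      cu≢cv = Edge⇒distinct-colours He u∈e v∈e u≢v
      -- Enumerates the two colours besides those of `u` and `v`: the outer `punchIn` skips `col u`,
      -- the inner one skips the place of `col v` among the remaining three.
      other : Fin 2 → Fin 4
      other = punchIn (col u) ∘ punchIn (punchOut cu≢cv)
      cv-avoided : ∀ c → col v ≢ other c
      cv-avoided c eq = punchInᵢ≢i (punchOut cu≢cv) c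
        (punchIn-injective (col u) _ _ (trans (sym eq) (sym (punchIn-punchOut cu≢cv))))
      -- An index below 2q is read as a choice of remaining colour and a position in its class.
      -- Injectivity recovers first the colour, then the position.
      w : Fin (2 * q) → Fin n
      w x = let c , i = remQuot {2} q x in pick (other c) i
      w-injective : Injective _≡_ _≡_ w
      w-injective {x} {y} eq =
        let c , i   = remQuot {2} q x
            c′ , i′ = remQuot {2} q y
            oc≡oc′  = trans (sym (col-pick (other c) i)) (trans (cong col eq) (col-pick (other c′) i′))
            c≡c′    = punchIn-injective (punchOut cu≢cv) c c′ (punchIn-injective (col u) _ _ oc≡oc′)
            i≡i′    = pick-injective (other c)
                        (trans eq (cong (λ z → pick (other z) i′) (sym c≡c′)))
        in trans (sym (combine-remQuot {2} q x))
             (trans (cong₂ combine c≡c′ i≡i′) (combine-remQuot {2} q y))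

    rainbow-NonEmpty : Fin q → NonEmpty rainbow
    rainbow-NonEmpty i = _ , distinct-colours⇒Edge
      {pick (# 0) i} {pick (# 1) i} {pick (# 2) i} (differ λ ()) (differ λ ()) (differ λ ())
      where
      differ : ∀ {c c′} → c ≢ c′ → col (pick c i) ≢ col (pick c′ i)
      differ c≢c′ eq = c≢c′ (trans (sym (col-pick _ i)) (trans eq (col-pick _ i)))

    rainbow-δ₂⁺ : ∀ {d} → Isδ₂⁺ rainbow d → 2 * q ≤ d
    rainbow-δ₂⁺ (inj₂ (_ , _ , max)) = max _ rainbow-codegrees
    rainbow-δ₂⁺ (inj₁ (empty , refl)) = nonpositive rainbow-NonEmpty
      where
      -- If the rainbow 3-graph is empty, its co-degree is 0 by convention and `q` must be 0.
      -- Quantifying over `q` afresh permits the case split on a module parameter.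
      nonpositive : ∀ {q} → (Fin q → NonEmpty rainbow) → 2 * q ≤ 0
      nonpositive {zero}  ne = z≤n
      nonpositive {suc q} ne = contradiction (ne zero) empty

-- The lower bound from residues modulo 4

Attained-lower-bound : ∀ n → ∃[ k ] Attained n k × 2 * (n / 4) ≤ k
Attained-lower-bound n =
  let d , isδ = Isδ₂⁺-exists rainbow
  in d , (rainbow , rainbow-Free , isδ) , rainbow-δ₂⁺ pick col-pick pick-injective isδ
  where
  open Rainbow {n} (λ i → toℕ i mod 4)
  q = n / 4
  -- The vertex 4i + c has residue c and lies below 4q ≤ n, so each residue class contains at least
  -- q vertices.
  pick : Fin 4 → Fin q → Fin n
  pick c i = inject≤ (combine i c) (m/n*n≤m n 4)
  pick-injective : ∀ c → Injective _≡_ _≡_ (pick c)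
  pick-injective c {i} {j} eq =
    combine-injectiveˡ i c j c (inject≤-injective (m/n*n≤m n 4) (m/n*n≤m n 4) _ _ eq)
  col-pick : ∀ c i → toℕ (pick c i) mod 4 ≡ c
  col-pick c i = toℕ-injective (begin
    toℕ (toℕ (pick c i) mod 4)    ≡⟨ toℕ-fromℕ< (m%n<n (toℕ (pick c i)) 4) ⟩
    toℕ (pick c i) % 4            ≡⟨ cong (_% 4) (toℕ-inject≤ (combine i c) (m/n*n≤m n 4)) ⟩
    toℕ (combine i c) % 4         ≡⟨ cong (_% 4) (toℕ-combine i c) ⟩
    (4 * toℕ i + toℕ c) % 4       ≡⟨ cong (_% 4) (ℕ.+-comm (4 * toℕ i) (toℕ c)) ⟩
    (toℕ c + 4 * toℕ i) % 4       ≡⟨ cong (λ x → (toℕ c + x) % 4) (ℕ.*-comm 4 (toℕ i)) ⟩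
    (toℕ c + toℕ i * 4) % 4       ≡⟨ [m+kn]%n≡m%n (toℕ c) (toℕ i) 4 ⟩
    toℕ c % 4                     ≡⟨ m<n⇒m%n≡m (toℕ<n c) ⟩
    toℕ c                         ∎)
    where open ≡-Reasoning

-- Not opened earlier: prefix + makes ∣ p ∣ + ∣ q ∣ ambiguous to parse.
open import Data.Integer using (+_)

-- Rational form of the upper bound, and both bounds combined

3m≤2n⇒m≤2/3*n : ∀ m n → 3 * m ≤ 2 * n → (+ m ℚ./ 1) ℚ.≤ (+ 2 ℚ./ 3) ℚ.* (+ n ℚ./ 1)
3m≤2n⇒m≤2/3*n m n 3m≤2n = ℚₚ.toℚᵘ-cancel-≤ (begin
  ℚ.toℚᵘ (+ m ℚ./ 1)                            ≃⟨ ℚₚ.toℚᵘ-fromℚᵘ (+ m ℚᵘ./ 1) ⟩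
  + m ℚᵘ./ 1                                    ≤⟨ ℚᵘ.*≤* cross ⟩
  (+ 2 ℚᵘ./ 3) ℚᵘ.* (+ n ℚᵘ./ 1)                ≃⟨ ℚᵘₚ.*-congˡ {+ 2 ℚᵘ./ 3} (ℚₚ.toℚᵘ-fromℚᵘ (+ n ℚᵘ./ 1)) ⟨
  (+ 2 ℚᵘ./ 3) ℚᵘ.* ℚ.toℚᵘ (+ n ℚ./ 1)          ≃⟨ ℚₚ.toℚᵘ-homo-* (+ 2 ℚ./ 3) (+ n ℚ./ 1) ⟨
  ℚ.toℚᵘ ((+ 2 ℚ./ 3) ℚ.* (+ n ℚ./ 1))          ∎)
  where
  open ℚᵘₚ.≤-Reasoning
  -- For unnormalised fractions the order is cross-multiplication, which here is 3m ≤ 2n up to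
  -- integer rewriting.
  cross : + m ℤ.* + 3 ℤ.≤ (+ 2 ℤ.* + n) ℤ.* + 1
  cross = subst₂ ℤ._≤_
    (trans (cong +_ (ℕ.*-comm 3 m)) (ℤₚ.pos-* m 3))
    (trans (ℤₚ.pos-* 2 n) (sym (ℤₚ.*-identityʳ (+ 2 ℤ.* + n))))
    (ℤ.+≤+ 3m≤2n)

theorem14 : ∀ (n : ℕ) → .{{NonZero n}} →
    ∃ λ m → IsCo⁺ex n C₅ m
    × 2 * (n / 4) ≤ m
    × (+ m ℚ./ 1) ℚ.≤ (+ 2 ℚ./ 3) ℚ.* (+ n ℚ./ 1)
theorem14 n =
  let m , attained , m-max = co⁺ex-exists n
      k , k-attained , 2q≤k = Attained-lower-bound n
  in m , (attained , m-max) , ℕ.≤-trans 2q≤k (m-max k k-attained) ,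
     3m≤2n⇒m≤2/3*n m n (Attained⇒≤ attained)
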